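{- Let $k\ge3$ be fixed. For $G\in\mathcal{X}_{n,k}$, the (normalized) minimal norm $\nu(G)$ of the Jacobian of $G$ satisfies $$\nu(G)=O(\log_{k-1}n)\qquad (n\to\infty),$$ that is, there is a constant $C$ depending only on $k$ such that $\nu(G)\le C\log_{k-1}n$ for all $n$ and all $G\in\mathcal{X}_{n,k}$.
   Context: $\mathcal{X}_{n,k}$ is the set of finite simple connected $k$-regular graphs with $n$ vertices. For a graph $G$ with oriented edges, the lattice of integral flows $\Lambda^1(G)\subset\mathbf{R}^{E(G)}$ consists of the integer-valued functions on edges for which inflow equals outflow at every vertex, with the Euclidean inner product; for $G\in\mathcal{X}_{n,k}$ it has dimension $kn/2-n+1$. Its determinant is the number $\tau(G)$ of spanning trees of $G$, and its (unnormalized) minimal norm (minimal value of the squared length of a nonzero vector) is the girth $\gamma(G)$. The Jacobian of $G$ is the finite group $(\Lambda^1)^{\#}/\Lambda^1$, where $(\Lambda^1)^{\#}$ is the dual lattice. The normalized minimal norm is defined by $$\nu(G)=\gamma(G)\,\tau(G)^{2/(kn/2-n+1)} .$$ -}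

module Defs where

open import Data.Empty using (⊥)
open import Data.Fin.Base as Fin using (Fin)
import Data.Fin.Properties as Fin
open import Data.Integer.Base as ℤ using (+_; -[1+_])
import Data.Integer.Properties as ℤ
open import Data.List.Base as List
  using (List; []; _∷_; _++_; allFin; cartesianProduct; filter; head; length; map; upTo)
import Data.List.Membership.DecPropositional as DecMembership
open import Data.Maybe.Base using (fromMaybe)
open import Data.Nat.Base
open import Data.Nat.DivMod using (_/_)
open import Data.Nat.Properties
open import Data.Nat.Solver using (module +-*-Solver)
open import Data.Product.Base using (Σ; Σ-syntax; ∃; ∃₂; _×_; _,_; proj₁; proj₂)
import Data.Product.Properties as Product
open import Data.Rational.Unnormalised.Base as ℚ using (ℚᵘ; mkℚᵘ; 0ℚᵘ)
import Data.Rational.Unnormalised.Properties as ℚ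
open import Data.Sum.Base using (_⊎_; inj₁; inj₂)
open import Data.Unit.Base using (⊤; tt)
open import Data.Vec.Base as Vec using (Vec; []; _∷_)
open import Data.Vec.Relation.Unary.Linked using (Linked; linked?)
import Data.Vec.Relation.Unary.AllPairs as AllPairs
open import Data.Vec.Relation.Unary.Unique.Propositional using (Unique)
open import Data.Vec.Relation.Unary.Unique.Propositional.Properties
  using (lookup-injective)
open import Function.Base using (_∘_)
open import Level using (0ℓ)
open import Relation.Binary.Core using (Rel)
open import Relation.Binary.Definitions as B using (tri<; tri≈; tri>)
open import Relation.Binary.PropositionalEquality
  using (_≡_; refl; sym; trans; cong; subst; subst₂)
open import Relation.Nullary.Decidable
  using (Dec; yes; no; map′; ¬?; _×-dec_; _⊎-dec_)
open import Relation.Nullary.Negation.Core using (¬_; contradiction)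
import Relation.Unary as U

open +-*-Solver using (solve; con; _:+_; _:*_; _:=_)

------------------------------------------------------------------------
-- Non-negative real numbers

-- A non-negative real x is given by its open lower Dedekind cut
-- { q ∈ ℚ | q < x }.  By `down`, the cut respects equality of
-- unnormalised fractions.

record ℝ≥0 : Set₁ where
  field
    Below    : ℚᵘ → Set
    negative : ∀ {q} → q ℚ.< 0ℚᵘ → Below q
    down     : ∀ {p q} → p ℚ.≤ q → Below q → Below p
    open′    : ∀ {p} → Below p → ∃ λ q → p ℚ.< q × Below q
    bounded  : ∃ λ q → ¬ Below q

open ℝ≥0 public using (Below)

infix 4 _≤ᴿ_

_≤ᴿ_ : ℝ≥0 → ℝ≥0 → Set
x ≤ᴿ y = ∀ q → Below x q → Below y q

infixl 7 _*ᴿ_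

_*ᴿ_ : ℝ≥0 → ℝ≥0 → ℝ≥0
x *ᴿ y = record
  { Below    = λ q → q ℚ.< 0ℚᵘ ⊎
      ∃₂ λ a b → 0ℚᵘ ℚ.≤ a × 0ℚᵘ ℚ.≤ b × Below x a × Below y b × q ℚ.≤ a ℚ.* b
  ; negative = inj₁
  ; down     = λ
      { p≤q (inj₁ q<0) → inj₁ (ℚ.≤-<-trans p≤q q<0)
      ; p≤q (inj₂ (a , b , 0≤a , 0≤b , a<x , b<y , q≤ab)) →
          inj₂ (a , b , 0≤a , 0≤b , a<x , b<y , ℚ.≤-trans p≤q q≤ab) }
  ; open′    = λ
      { (inj₁ p<0) → let (r , p<r , r<0) = ℚ.<-dense p<0 in r , p<r , inj₁ r<0
      ; (inj₂ (a , b , 0≤a , 0≤b , a<x , b<y , p≤ab)) →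
          let (a′ , a<a′ , a′<x) = X.open′ a<x
              (b′ , b<b′ , b′<y) = Y.open′ b<y
          in a′ ℚ.* b′ , ℚ.≤-<-trans p≤ab (*-mono-<′ 0≤a 0≤b a<a′ b<b′) ,
             inj₂ (a′ , b′ , ℚ.≤-trans 0≤a (ℚ.<⇒≤ a<a′) , ℚ.≤-trans 0≤b (ℚ.<⇒≤ b<b′)
                  , a′<x , b′<y , ℚ.≤-refl) }
  ; bounded  = u ℚ.* v , λ
      { (inj₁ uv<0) → ℚ.<⇒≱ uv<0 (ℚ.≤-trans
          (ℚ.≤-reflexive (ℚ.≃-sym (ℚ.*-zeroˡ v)))
          (ℚ.*-monoˡ-≤-nonNeg v {{ℚ.nonNegative (above-≥0 y v≮y)}} (above-≥0 x u≮x)))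
      ; (inj₂ (a , b , 0≤a , 0≤b , a<x , b<y , uv≤ab)) →
          ℚ.<⇒≱ (*-mono-<′ 0≤a 0≤b (above x u≮x a<x) (above y v≮y b<y)) uv≤ab }
  }
  where
  module X = ℝ≥0 x
  module Y = ℝ≥0 y
  u = proj₁ X.bounded
  v = proj₁ Y.bounded
  u≮x = proj₂ X.bounded
  v≮y = proj₂ Y.bounded

  above : ∀ z {w a} → ¬ Below z w → Below z a → a ℚ.< w
  above z w≮z a<z = ℚ.≰⇒> (λ w≤a → w≮z (ℝ≥0.down z w≤a a<z))

  above-≥0 : ∀ z {w} → ¬ Below z w → 0ℚᵘ ℚ.≤ w
  above-≥0 z w≮z = ℚ.≮⇒≥ (w≮z ∘ ℝ≥0.negative z)

  *-mono-<′ : ∀ {a b c d} → 0ℚᵘ ℚ.≤ a → 0ℚᵘ ℚ.≤ b → a ℚ.< c → b ℚ.< d →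
              a ℚ.* b ℚ.< c ℚ.* d
  *-mono-<′ {a} {b} {c} {d} 0≤a 0≤b a<c b<d = ℚ.≤-<-trans
    (ℚ.*-monoʳ-≤-nonNeg a {{ℚ.nonNegative 0≤a}} (ℚ.<⇒≤ b<d))
    (ℚ.*-monoˡ-<-pos d {{ℚ.positive (ℚ.≤-<-trans 0≤b b<d)}} a<c)

-- The real number x for which `B p q` expresses p / q < x, for p ≥ 0
-- and q ≥ 1.

module _ (B : ℕ → ℕ → Set)
         (B-down : ∀ p q p′ q′ .{{_ : NonZero q}} .{{_ : NonZero q′}} →
                   p * q′ ≤ p′ * q → B p′ q′ → B p q)
         (B-open : ∀ p q → B p (suc q) →
                   ∃₂ λ p′ q′ → p * suc q′ < p′ * suc q × B p′ (suc q′))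
         (B-bounded : ∃ λ u → ¬ B u 1)
         where

  private
    Cut : ℚᵘ → Set
    Cut (mkℚᵘ (+ p) q-1)    = B p (suc q-1)
    Cut (mkℚᵘ -[1+ _ ] q-1) = ⊤

  fromFractions : ℝ≥0
  fromFractions = record
    { Below    = Cut
    ; negative = neg
    ; down     = dwn
    ; open′    = opn
    ; bounded  = mkℚᵘ (+ proj₁ B-bounded) 0 , proj₂ B-bounded
    }
    where
    neg : ∀ {q} → q ℚ.< 0ℚᵘ → Cut q
    neg {mkℚᵘ (+ zero) _}    (ℚ.*<* (ℤ.+<+ ()))
    neg {mkℚᵘ (+ (suc _)) _} (ℚ.*<* (ℤ.+<+ ()))
    neg {mkℚᵘ -[1+ _ ] _} _ = tt

    dwn : ∀ {p q} → p ℚ.≤ q → Cut q → Cut p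
    dwn {mkℚᵘ -[1+ _ ] _} _ _ = tt
    dwn {mkℚᵘ (+ m) c} {mkℚᵘ (+ n) d} (ℚ.*≤* le) q<x =
      B-down m (suc c) n (suc d) (ℤ.drop‿+≤+ (subst₂ ℤ._≤_
        (sym (ℤ.pos-* m (suc d))) (sym (ℤ.pos-* n (suc c))) le)) q<x
    dwn {mkℚᵘ (+ zero) c}  {mkℚᵘ -[1+ _ ] _} (ℚ.*≤* ())
    dwn {mkℚᵘ (+ suc _) c} {mkℚᵘ -[1+ _ ] _} (ℚ.*≤* ())

    opn : ∀ {p} → Cut p → ∃ λ q → p ℚ.< q × Cut q
    opn {mkℚᵘ -[1+ m ] c} _ =
      let (r , p<r , r<0) = ℚ.<-dense { mkℚᵘ -[1+ m ] c} {0ℚᵘ} (ℚ.*<* ℤ.-<+)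
      in r , p<r , neg r<0
    opn {mkℚᵘ (+ m) c} p<x =
      let (m′ , c′ , lt , q<x) = B-open m c p<x
      in mkℚᵘ (+ m′) c′ , ℚ.*<* (subst₂ ℤ._<_
           (ℤ.pos-* m (suc c′)) (ℤ.pos-* m′ (suc c)) (ℤ.+<+ lt)) , q<x

fromℕ : ℕ → ℝ≥0
fromℕ m = fromFractions (λ p q → p < m * q) dwn opn (m , bdd)
  where
  open ≤-Reasoning

  dwn : ∀ p q p′ q′ .{{_ : NonZero q}} .{{_ : NonZero q′}} →
        p * q′ ≤ p′ * q → p′ < m * q′ → p < m * q
  dwn p q p′ q′ le lt = *-cancelʳ-< q′ p (m * q) (begin-strict
    p * q′        ≤⟨ le ⟩
    p′ * q        <⟨ *-monoˡ-< q lt ⟩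
    m * q′ * q    ≡⟨ solve 3 (λ m q q′ → m :* q′ :* q := m :* q :* q′) refl m q q′ ⟩
    m * q * q′    ∎)

  opn : ∀ p q → p < m * suc q →
        ∃₂ λ p′ q′ → p * suc q′ < p′ * suc q × p′ < m * suc q′
  opn p q lt = suc (2 * p) , q + 1 * suc q , lt₁ , lt₂
    where
    lt₁ : p * (2 * suc q) < suc (2 * p) * suc q
    lt₁ = begin-strict
      p * (2 * suc q)            <⟨ m<n+m (p * (2 * suc q)) {suc q} z<s ⟩
      suc q + p * (2 * suc q)
        ≡⟨ solve 2 (λ p q → q :+ p :* (con 2 :* q) := (con 1 :+ con 2 :* p) :* q) refl p (suc q) ⟩
      suc (2 * p) * suc q        ∎
    lt₂ : suc (2 * p) < m * (2 * suc q)
    lt₂ = begin-strict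
      suc (2 * p)          <⟨ n<1+n _ ⟩
      suc (suc (2 * p))    ≡⟨ solve 1 (λ p → con 2 :+ con 2 :* p := con 2 :* (con 1 :+ p)) refl p ⟩
      2 * suc p            ≤⟨ *-monoʳ-≤ 2 lt ⟩
      2 * (m * suc q)      ≡⟨ solve 2 (λ m q → con 2 :* (m :* q) := m :* (con 2 :* q)) refl m (suc q) ⟩
      m * (2 * suc q)      ∎

  bdd : ¬ (m < m * 1)
  bdd lt = <-irrefl (sym (*-identityʳ m)) lt

private
  *-^-distrib : ∀ m n d → (m * n) ^ d ≡ m ^ d * n ^ d
  *-^-distrib m n zero    = refl
  *-^-distrib m n (suc d) = trans (cong (m * n *_) (*-^-distrib m n d))
    (solve 4 (λ a b x y → a :* b :* (x :* y) := a :* x :* (b :* y)) refl m n (m ^ d) (n ^ d))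

-- t ^[ e / d ] is the real power t^(e/d), that is sup { q | q^d < t^e }.

infix 8 _^[_/_]

_^[_/_] : (t e d : ℕ) .{{_ : NonZero d}} → ℝ≥0
t ^[ e / d ] = fromFractions (λ p q → p ^ d < T * q ^ d) dwn opn (T , bdd d)
  where
  open ≤-Reasoning
  T = t ^ e

  dwn : ∀ p q p′ q′ .{{_ : NonZero q}} .{{_ : NonZero q′}} →
        p * q′ ≤ p′ * q → p′ ^ d < T * q′ ^ d → p ^ d < T * q ^ d
  dwn p q p′ q′ le lt = *-cancelʳ-< (q′ ^ d) (p ^ d) (T * q ^ d) (begin-strict
    p ^ d * q′ ^ d      ≡⟨ *-^-distrib p q′ d ⟨
    (p * q′) ^ d        ≤⟨ ^-monoˡ-≤ d le ⟩
    (p′ * q) ^ d        ≡⟨ *-^-distrib p′ q d ⟩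
    p′ ^ d * q ^ d      <⟨ *-monoˡ-< (q ^ d) {{m^n≢0 q d}} lt ⟩
    T * q′ ^ d * q ^ d
      ≡⟨ solve 3 (λ m q q′ → m :* q′ :* q := m :* q :* q′) refl T (q ^ d) (q′ ^ d) ⟩
    T * q ^ d * q′ ^ d  ∎)

  K : ℕ → ℕ → ℕ
  K p zero    = 0
  K p (suc d) = p * K p d + p ^ d + K p d

  expand : ∀ M .{{_ : NonZero M}} p d → M * suc (M * p) ^ d ≤ M ^ d * (M * p ^ d + K p d)
  expand M p zero    = ≤-reflexive
    (solve 1 (λ M → M :* con 1 := con 1 :* (M :* con 1 :+ con 0)) refl M)
  expand M p (suc d) = begin
    M * (suc (M * p) * suc (M * p) ^ d)
      ≡⟨ solve 3 (λ M y z → M :* (y :* z) := y :* (M :* z)) refl M (suc (M * p)) (suc (M * p) ^ d) ⟩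
    suc (M * p) * (M * suc (M * p) ^ d)
      ≤⟨ *-monoʳ-≤ (suc (M * p)) (expand M p d) ⟩
    suc (M * p) * (M ^ d * (M * p ^ d + K p d))
      ≡⟨ solve 5 (λ M p m x k → (con 1 :+ M :* p) :* (m :* (M :* x :+ k))
           := m :* (M :* (M :* (p :* x) :+ (p :* k :+ x)) :+ k)) refl M p (M ^ d) (p ^ d) (K p d) ⟩
    M ^ d * (M * (M * (p * p ^ d) + (p * K p d + p ^ d)) + K p d)
      ≤⟨ *-monoʳ-≤ (M ^ d) (+-monoʳ-≤ (M * (M * (p * p ^ d) + (p * K p d + p ^ d)))
           (m≤n*m (K p d) M)) ⟩
    M ^ d * (M * (M * (p * p ^ d) + (p * K p d + p ^ d)) + M * K p d)
      ≡⟨ solve 5 (λ M p m x k → m :* (M :* (M :* (p :* x) :+ (p :* k :+ x)) :+ M :* k)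
           := M :* m :* (M :* (p :* x) :+ (p :* k :+ x :+ k))) refl M p (M ^ d) (p ^ d) (K p d) ⟩
    M * M ^ d * (M * (p * p ^ d) + (p * K p d + p ^ d + K p d)) ∎

  opn : ∀ p q → p ^ d < T * suc q ^ d →
        ∃₂ λ p′ q′ → p * suc q′ < p′ * suc q × p′ ^ d < T * suc q′ ^ d
  opn p q lt = suc (M * p) , q + K p d * suc q , lt₁ , lt₂
    where
    M = suc (K p d)
    lt₁ : p * (M * suc q) < suc (M * p) * suc q
    lt₁ = begin-strict
      p * (M * suc q)            <⟨ m<n+m (p * (M * suc q)) {suc q} z<s ⟩
      suc q + p * (M * suc q)
        ≡⟨ solve 3 (λ M p q → q :+ p :* (M :* q) := (con 1 :+ M :* p) :* q) refl M p (suc q) ⟩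
      suc (M * p) * suc q        ∎
    lt₂ : suc (M * p) ^ d < T * (M * suc q) ^ d
    lt₂ = *-cancelˡ-< M _ _ (begin-strict
      M * suc (M * p) ^ d            ≤⟨ expand M p d ⟩
      M ^ d * (M * p ^ d + K p d)    <⟨ *-monoʳ-< (M ^ d) {{m^n≢0 M d}}
                                          (+-monoʳ-< (M * p ^ d) (n<1+n (K p d))) ⟩
      M ^ d * (M * p ^ d + M)
        ≡⟨ solve 3 (λ M m x → m :* (M :* x :+ M) := M :* (m :* (con 1 :+ x))) refl M (M ^ d) (p ^ d) ⟩
      M * (M ^ d * suc (p ^ d))      ≤⟨ *-monoʳ-≤ M (*-monoʳ-≤ (M ^ d) lt) ⟩
      M * (M ^ d * (T * suc q ^ d))
        ≡⟨ cong (M *_) (solve 3 (λ m t x → m :* (t :* x) := t :* (m :* x)) refl (M ^ d) T (suc q ^ d)) ⟩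
      M * (T * (M ^ d * suc q ^ d))  ≡⟨ cong (λ x → M * (T * x)) (*-^-distrib M (suc q) d) ⟨
      M * (T * (M * suc q) ^ d)      ∎)

  x≤x^d : ∀ x d .{{_ : NonZero d}} → x ≤ x ^ d
  x≤x^d zero      d       = z≤n
  x≤x^d x@(suc _) (suc d) = m≤m*n x (x ^ d) {{m^n≢0 x d}}

  bdd : ∀ d .{{_ : NonZero d}} → ¬ (T ^ d < T * 1 ^ d)
  bdd d lt = <⇒≱ (subst (T ^ d <_) (trans (cong (T *_) (^-zeroˡ d)) (*-identityʳ T)) lt) (x≤x^d T d)

-- The logarithm of n ≥ 1 to base b ≥ 2: for q ≥ 1, p / q < log_b n
-- means b^p < n^q.

log : (b n : ℕ) → 2 ≤ b → 1 ≤ n → ℝ≥0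
log b n 2≤b 1≤n = fromFractions (λ p q → b ^ p < n ^ q) dwn opn (n , bdd)
  where
  open ≤-Reasoning
  instance
    b≢0 : NonZero b
    b≢0 = >-nonZero (≤-trans z<s 2≤b)
    n≢0 : NonZero n
    n≢0 = >-nonZero 1≤n

  dwn : ∀ p q p′ q′ .{{_ : NonZero q}} .{{_ : NonZero q′}} →
        p * q′ ≤ p′ * q → b ^ p′ < n ^ q′ → b ^ p < n ^ q
  dwn p q p′ q′ le lt = ≰⇒> λ n^q≤b^p → <⇒≱ (begin-strict
    (b ^ p) ^ q′    ≡⟨ ^-*-assoc b p q′ ⟩
    b ^ (p * q′)    ≤⟨ ^-monoʳ-≤ b le ⟩
    b ^ (p′ * q)    ≡⟨ ^-*-assoc b p′ q ⟨
    (b ^ p′) ^ q    <⟨ ^-monoˡ-< q lt ⟩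
    (n ^ q′) ^ q    ≡⟨ ^-*-assoc n q′ q ⟩
    n ^ (q′ * q)    ≡⟨ cong (n ^_) (*-comm q′ q) ⟩
    n ^ (q * q′)    ≡⟨ ^-*-assoc n q q′ ⟨
    (n ^ q) ^ q′    ∎) (^-monoˡ-≤ q′ n^q≤b^p)

  bernoulli : ∀ x M → (x + M) * x ^ M ≤ x * suc x ^ M
  bernoulli x zero    = ≤-reflexive
    (solve 1 (λ x → (x :+ con 0) :* con 1 := x :* con 1) refl x)
  bernoulli x (suc M) = begin
    (x + suc M) * (x * x ^ M)
      ≤⟨ m≤n+m _ (M * x ^ M) ⟩
    M * x ^ M + (x + suc M) * (x * x ^ M)
      ≡⟨ solve 3 (λ x M y → M :* y :+ (x :+ (con 1 :+ M)) :* (x :* y)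
           := (con 1 :+ x) :* ((x :+ M) :* y)) refl x M (x ^ M) ⟩
    suc x * ((x + M) * x ^ M)
      ≤⟨ *-monoʳ-≤ (suc x) (bernoulli x M) ⟩
    suc x * (x * suc x ^ M)
      ≡⟨ solve 3 (λ x y z → y :* (x :* z) := x :* (y :* z)) refl x (suc x) (suc x ^ M) ⟩
    x * (suc x * suc x ^ M) ∎

  opn : ∀ p q → b ^ p < n ^ suc q →
        ∃₂ λ p′ q′ → p * suc q′ < p′ * suc q × b ^ p′ < n ^ suc q′
  opn p q lt = suc (M * p) , q + b * x * suc q , lt₁ , lt₂
    where
    x = b ^ p
    M = suc (b * x)
    instance
      x≢0 : NonZero x
      x≢0 = m^n≢0 b p
    lt₁ : p * (M * suc q) < suc (M * p) * suc q
    lt₁ = begin-strict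
      p * (M * suc q)            <⟨ m<n+m (p * (M * suc q)) {suc q} z<s ⟩
      suc q + p * (M * suc q)
        ≡⟨ solve 3 (λ M p q → q :+ p :* (M :* q) := (con 1 :+ M :* p) :* q) refl M p (suc q) ⟩
      suc (M * p) * suc q        ∎
    lt₂ : b * b ^ (M * p) < n ^ (M * suc q)
    lt₂ = *-cancelˡ-< x _ _ (begin-strict
      x * (b * b ^ (M * p))      ≡⟨ cong (λ z → x * (b * b ^ z)) (*-comm M p) ⟩
      x * (b * b ^ (p * M))      ≡⟨ cong (λ z → x * (b * z)) (^-*-assoc b p M) ⟨
      x * (b * x ^ M)            ≡⟨ solve 3 (λ x b y → x :* (b :* y) := b :* x :* y) refl x b (x ^ M) ⟩
      b * x * x ^ M              <⟨ *-monoˡ-< (x ^ M) {{m^n≢0 x M}}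
                                      (≤-trans (n<1+n (b * x)) (m≤n+m M x)) ⟩
      (x + M) * x ^ M            ≤⟨ bernoulli x M ⟩
      x * suc x ^ M              ≤⟨ *-monoʳ-≤ x (^-monoˡ-≤ M lt) ⟩
      x * (n ^ suc q) ^ M        ≡⟨ cong (x *_) (^-*-assoc n (suc q) M) ⟩
      x * n ^ (suc q * M)        ≡⟨ cong (λ z → x * n ^ z) (*-comm (suc q) M) ⟩
      x * n ^ (M * suc q)        ∎)

  m<b^m : ∀ m → m < b ^ m
  m<b^m zero    = z<s
  m<b^m (suc m) = begin-strict
    suc m          ≤⟨ m<b^m m ⟩
    b ^ m          <⟨ m<n+m (b ^ m) (m^n>0 b m) ⟩
    b ^ m + b ^ m  ≡⟨ solve 1 (λ y → y :+ y := con 2 :* y) refl (b ^ m) ⟩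
    2 * b ^ m      ≤⟨ *-monoˡ-≤ (b ^ m) 2≤b ⟩
    b * b ^ m      ∎

  bdd : ¬ (b ^ n < n ^ 1)
  bdd lt = <-asym (m<b^m n) (subst (b ^ n <_) (^-identityʳ n) lt)

------------------------------------------------------------------------
-- Paths and cycles

module _ {n : ℕ} (_~_ : Rel (Fin n) 0ℓ) where

  IsPath : ∀ {ℓ} → Vec (Fin n) ℓ → Set
  IsPath vs = Linked _~_ vs × Unique vs

  IsPathFromTo : Fin n → Fin n → ∀ {ℓ} → Vec (Fin n) ℓ → Set
  IsPathFromTo u v []           = ⊥
  IsPathFromTo u v vs@(_ ∷ _) = Vec.head vs ≡ u × Vec.last vs ≡ v × IsPath vs

  IsCycle : ∀ {ℓ} → Vec (Fin n) ℓ → Set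
  IsCycle         []           = ⊥
  IsCycle {ℓ} vs@(_ ∷ _) = 3 ≤ ℓ × Vec.last vs ~ Vec.head vs × IsPath vs

  HasCycle : ℕ → Set
  HasCycle ℓ = ∃ λ (vs : Vec (Fin n) ℓ) → IsCycle vs

  Connected : Set
  Connected = NonZero n × (∀ u v → ∃₂ λ ℓ (vs : Vec (Fin n) ℓ) → IsPathFromTo u v vs)

  Acyclic : Set
  Acyclic = ∀ ℓ → ¬ HasCycle ℓ

  IsTree : Set
  IsTree = Connected × Acyclic

module _ {n : ℕ} {_~_ : Rel (Fin n) 0ℓ} (_~?_ : B.Decidable _~_) where

  private
    isPath? : ∀ {ℓ} → U.Decidable (IsPath _~_ {ℓ})
    isPath? vs = linked? _~?_ vs ×-dec AllPairs.allPairs? (λ u v → ¬? (u Fin.≟ v)) vs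

    isPathFromTo? : ∀ u v {ℓ} → U.Decidable (IsPathFromTo _~_ u v {ℓ})
    isPathFromTo? u v []          = no λ ()
    isPathFromTo? u v vs@(_ ∷ _) =
      Vec.head vs Fin.≟ u ×-dec Vec.last vs Fin.≟ v ×-dec isPath? vs

    isCycle? : ∀ {ℓ} → U.Decidable (IsCycle _~_ {ℓ})
    isCycle?     []          = no λ ()
    isCycle? {ℓ} vs@(_ ∷ _) =
      3 ≤? ℓ ×-dec Vec.last vs ~? Vec.head vs ×-dec isPath? vs

    anyVec? : ∀ {ℓ} {P : Vec (Fin n) ℓ → Set} → U.Decidable P → Dec (∃ P)
    anyVec? {zero}  P? = map′ ([] ,_) (λ { ([] , p) → p }) (P? [])
    anyVec? {suc ℓ} P? = map′ (λ { (v , vs , p) → v ∷ vs , p }) (λ { (v ∷ vs , p) → v , vs , p })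
      (Fin.any? λ v → anyVec? λ vs → P? (v ∷ vs))

    unique⇒≤ : ∀ {ℓ} {vs : Vec (Fin n) ℓ} → Unique vs → ℓ ≤ n
    unique⇒≤ vs! = Fin.injective⇒≤ (λ {i} {j} → lookup-injective vs! i j)

    anyLength? : {P : ∀ ℓ → Vec (Fin n) ℓ → Set} → (∀ ℓ → U.Decidable (P ℓ)) →
                 (∀ {ℓ vs} → P ℓ vs → ℓ ≤ n) → Dec (∃₂ P)
    anyLength? P? P⇒≤ = map′ (λ { (ℓ , _ , vs , p) → ℓ , vs , p })
      (λ { (ℓ , vs , p) → ℓ , s≤s (P⇒≤ p) , vs , p })
      (anyUpTo? (λ ℓ → anyVec? (P? ℓ)) (suc n))

  hasCycle? : U.Decidable (HasCycle _~_)
  hasCycle? ℓ = anyVec? isCycle?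

  connected? : Dec (Connected _~_)
  connected? = nonZero? n ×-dec Fin.all? λ u → Fin.all? λ v →
    anyLength? (λ _ → isPathFromTo? u v)
      (λ { {vs = _ ∷ _} (_ , _ , _ , vs!) → unique⇒≤ vs! })

  acyclic? : Dec (Acyclic _~_)
  acyclic? = map′ (λ ¬c ℓ (vs , c) → ¬c (ℓ , vs , c)) (λ ac (ℓ , c) → ac ℓ c)
    (¬? (anyLength? (λ _ → isCycle?) (λ { {vs = _ ∷ _} (_ , _ , _ , vs!) → unique⇒≤ vs! })))

  isTree? : Dec (IsTree _~_)
  isTree? = connected? ×-dec acyclic?

------------------------------------------------------------------------
-- Graphs

record Graph (n : ℕ) : Set₁ where
  field
    _~_    : Rel (Fin n) 0ℓ
    _~?_   : B.Decidable _~_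
    ~-sym  : B.Symmetric _~_
    ~-irrefl : ∀ {v} → ¬ (v ~ v)

module _ {n : ℕ} (G : Graph n) where
  open Graph G

  degree : Fin n → ℕ
  degree u = length (filter (u ~?_) (allFin n))

  -- The length of a shortest cycle.  It is 0 if there is no cycle, which
  -- cannot happen when n ≥ 1 and all degrees are at least 2.
  girth : ℕ
  girth = fromMaybe 0 (head (filter (hasCycle? _~?_) (upTo (suc n))))

  -- Each edge is listed once, with its smaller endpoint first.
  edges : List (Fin n × Fin n)
  edges = filter (λ (u , v) → u Fin.<? v ×-dec u ~? v)
                 (cartesianProduct (allFin n) (allFin n))

Joined : ∀ {n} → List (Fin n × Fin n) → Rel (Fin n) 0ℓ
Joined F u v = (u , v) ∈ F ⊎ (v , u) ∈ F
  where open import Data.List.Membership.Propositional using (_∈_)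

joined? : ∀ {n} (F : List (Fin n × Fin n)) → B.Decidable (Joined F)
joined? F u v = (u , v) ∈? F ⊎-dec (v , u) ∈? F
  where open DecMembership (Product.≡-dec Fin._≟_ Fin._≟_) using (_∈?_)

-- As `edges G` has no repetitions, its sublists are the sets of edges of
-- G, each occurring once.
sublists : ∀ {A : Set} → List A → List (List A)
sublists []       = [] ∷ []
sublists (x ∷ xs) = map (x ∷_) (sublists xs) ++ sublists xs

-- The number of spanning trees.
τ : ∀ {n} → Graph n → ℕ
τ G = length (filter (λ F → isTree? (joined? F)) (sublists (edges G)))

record 𝒳 (n k : ℕ) : Set₁ where
  field
    graph     : Graph n
    connected : Connected (Graph._~_ graph)
    regular   : ∀ v → degree graph v ≡ k

  nonempty : 1 ≤ n
  nonempty = >-nonZero⁻¹ n {{proj₁ connected}}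

-- kn/2 - n + 1, the dimension of the lattice of integral flows of a graph
-- in 𝒳 n k.  Such a graph has kn/2 edges, so the division is exact, and
-- being connected it has at least n - 1 of them; the truncated
-- subtraction is exact when k ≥ 2.
dimFlows : (n k : ℕ) → ℕ
dimFlows n k = 1 + (k * n / 2 ∸ n)

ν : ∀ {n k} → 𝒳 n k → ℝ≥0
ν {n} {k} G = fromℕ (girth graph) *ᴿ τ graph ^[ 2 / dimFlows n k ]
  where open 𝒳 G

{-# OPTIONS --safe #-}

-- Both factors of ν(G) = γ(G) τ(G)^(2/d) are bounded crudely.  A graph has at
-- most 2^|E| spanning trees, |E| ≤ kn and kn ≤ 6d because k ≥ 3, so
-- τ(G)^(2/d) ≤ 2^12.  For the girth, suppose that G has no cycle of length at
-- most 2r.  Two non-backtracking walks of length r from a vertex v to a common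
-- endpoint coincide: otherwise, after removing their common final segment, the
-- first one followed by the reverse of the second is a closed non-backtracking
-- walk of length at most 2r, which contains a cycle.  So the endpoints of the
-- non-backtracking walks of length r from v are at least (k-1)^r distinct
-- vertices, all different from v.  This gives (k-1)^r < n, with γ(G) ≤ 4r.

module Submission where

open import Defs
open import Data.Fin.Base as Fin using (Fin; zero; suc; remQuot; combine; punchIn)
import Data.Fin.Properties as Fin
open import Data.Integer.Base as ℤ using (+_; -[1+_])
import Data.Integer.Properties as ℤ
open import Data.List.Base as List
  using (List; []; _∷_; allFin; cartesianProduct; filter; head; length; upTo)
open import Data.List.Membership.Propositional as List using ()
open import Data.List.Membership.Propositional.Properties
  using (∈-filter⁺; ∈-filter⁻; ∈-lookup; ∈-upTo⁺; ∈-upTo⁻)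
open import Data.List.Properties
  using (length-++; length-map; length-filter; length-tabulate; filter-++)
open import Data.List.Relation.Unary.All as All using ([]; _∷_)
open import Data.List.Relation.Unary.AllPairs as ListPairs using ([]; _∷_)
import Data.List.Relation.Unary.AllPairs.Properties as AllPairs
open import Data.List.Relation.Unary.Any as Any using (here; there)
open import Data.List.Relation.Unary.Any.Properties using (lookup-index)
import Data.List.Relation.Unary.Unique.Propositional as List
import Data.List.Relation.Unary.Unique.Propositional.Properties as Unique
open import Data.Maybe.Base using (fromMaybe)
open import Data.Nat.Base
open import Data.Nat.DivMod using (_/_; m≡m%n+[m/n]*n; m%n<n; m/n*n≤m)
open import Data.Nat.Properties
open import Data.Nat.Solver using (module +-*-Solver)
open import Data.Product.Base using (Σ-syntax; ∃; ∃₂; _×_; _,_; proj₁; proj₂)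
open import Data.Rational.Unnormalised.Base as ℚ using (ℚᵘ; mkℚᵘ; 0ℚᵘ)
import Data.Rational.Unnormalised.Properties as ℚ
open import Data.Sum.Base using (inj₁; inj₂)
open import Data.Unit.Base using (⊤; tt)
open import Data.Vec.Base as Vec using (Vec; []; _∷_)
import Data.Vec.Membership.DecPropositional as DecMembership
open import Data.Vec.Membership.Propositional using (_∈_)
open import Data.Vec.Relation.Unary.All as VecAll using ([]; _∷_)
open import Data.Vec.Relation.Unary.AllPairs using ([]; _∷_)
open import Data.Vec.Relation.Unary.Any using (here; there)
open import Data.Vec.Relation.Unary.Linked using (Linked; []; [-]; _∷_)
open import Data.Vec.Relation.Unary.Unique.Propositional using (Unique)
open import Function.Base using (_∘_)
open import Function.Definitions using (Injective)
open import Level using (0ℓ)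
open import Relation.Binary.Core using (Rel)
open import Relation.Binary.PropositionalEquality
  using (_≡_; _≢_; refl; sym; trans; cong; cong₂; subst; subst₂; module ≡-Reasoning)
open import Relation.Nullary.Decidable using (yes; no)
open import Relation.Nullary.Negation.Core using (¬_; contradiction)
open import Relation.Unary using (Pred; Decidable)

open +-*-Solver using (solve; con; _:+_; _:*_; _:=_)

-- Prefixes of vectors

data Prefix {A : Set} : ∀ {m n} → Vec A m → Vec A n → Set where
  []  : ∀ {n} {ys : Vec A n} → Prefix [] ys
  _∷_ : ∀ {m n} {xs : Vec A m} {ys : Vec A n} (x : A) → Prefix xs ys → Prefix (x ∷ xs) (x ∷ ys)

module _ {A : Set} where

  prefix-length : ∀ {m n} {xs : Vec A m} {ys : Vec A n} → Prefix xs ys → m ≤ n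
  prefix-length []      = z≤n
  prefix-length (_ ∷ p) = s≤s (prefix-length p)

  prefix-All : ∀ {P : A → Set} {m n} {xs : Vec A m} {ys : Vec A n} →
               Prefix xs ys → VecAll.All P ys → VecAll.All P xs
  prefix-All []      _          = []
  prefix-All (_ ∷ p) (py ∷ pys) = py ∷ prefix-All p pys

  prefix-Unique : ∀ {m n} {xs : Vec A m} {ys : Vec A n} → Prefix xs ys → Unique ys → Unique xs
  prefix-Unique []      _          = []
  prefix-Unique (_ ∷ p) (y∉ys ∷ ys!) = prefix-All p y∉ys ∷ prefix-Unique p ys!

  prefix-Linked : ∀ {R : Rel A 0ℓ} {m n} {xs : Vec A m} {ys : Vec A n} →
                  Prefix xs ys → Linked R ys → Linked R xs
  prefix-Linked []              _        = []
  prefix-Linked (_ ∷ [])        _        = [-]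
  prefix-Linked (_ ∷ p@(_ ∷ _)) (r ∷ rs) = r ∷ prefix-Linked p rs

  -- Used to cut a walk at the earlier occurrence of a repeated vertex, where it closes up into a
  -- cycle.
  prefix-to : ∀ {x n} {ys : Vec A n} → x ∈ ys →
              ∃₂ λ m (xs : Vec A (suc m)) → Prefix xs ys × Vec.last xs ≡ x
  prefix-to {x} (here refl) = 0 , x ∷ [] , x ∷ [] , refl
  prefix-to (there x∈ys) with m , xs , p , last≡x ← prefix-to x∈ys =
    suc m , _ ∷ xs , _ ∷ p , last≡x

  ∉⇒All≢ : ∀ {x n} {xs : Vec A n} → ¬ (x ∈ xs) → VecAll.All (x ≢_) xs
  ∉⇒All≢ {xs = []}    _    = []
  ∉⇒All≢ {xs = _ ∷ _} x∉xs = (x∉xs ∘ here) ∷ ∉⇒All≢ (x∉xs ∘ there)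

  last∈ : ∀ {n} (xs : Vec A (suc n)) → Vec.last xs ∈ xs
  last∈ (x ∷ [])     = here refl
  last∈ (x ∷ y ∷ xs) = there (last∈ (y ∷ xs))

-- Non-backtracking walks

_≢head_ : ∀ {A : Set} {n} → A → Vec A n → Set
x ≢head []      = ⊤
x ≢head (y ∷ _) = x ≢ y

-- The most recent vertex of a walk comes first.
data NonBacktracking {A : Set} (_~_ : Rel A 0ℓ) : ∀ {n} → Vec A n → Set where
  [-]  : ∀ {x} → NonBacktracking _~_ (x ∷ [])
  step : ∀ {x y n} {ys : Vec A n} → x ~ y → x ≢head ys →
         NonBacktracking _~_ (y ∷ ys) → NonBacktracking _~_ (x ∷ y ∷ ys)

nonBacktracking⇒linked : ∀ {A : Set} {_~_ : Rel A 0ℓ} {n} {xs : Vec A n} →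
                         NonBacktracking _~_ xs → Linked _~_ xs
nonBacktracking⇒linked [-]            = [-]
nonBacktracking⇒linked (step x~y _ w) = x~y ∷ nonBacktracking⇒linked w

module Walks {n : ℕ} (G : Graph n) where
  open Graph G
  open DecMembership (Fin._≟_ {n}) using (_∈?_)

  Walk : ∀ {ℓ} → Vec (Fin n) ℓ → Set
  Walk = NonBacktracking _~_

  module Acyclic≤ (N : ℕ) (¬cycle : ∀ ℓ → ℓ ≤ N → ¬ HasCycle _~_ ℓ) where

    -- If the newest vertex `x` recurs, irreflexivity and non-backtracking rule out the two
    -- positions before it, so the segment from `y` back to that occurrence is a cycle. Here `ℓ`
    -- counts vertices, so `suc N` allows `N` steps.
    walk-unique : ∀ {ℓ} {xs : Vec (Fin n) ℓ} → ℓ ≤ suc N → Walk xs → Unique xs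
    walk-unique _ [-] = [] ∷ []
    walk-unique {xs = x ∷ ys@(y ∷ zs)} (s≤s ℓ≤N) (step x~y x≢zs w) with x ∈? ys
    ... | no x∉ys = ∉⇒All≢ x∉ys ∷ walk-unique (m≤n⇒m≤1+n ℓ≤N) w
    ... | yes (here refl) = contradiction x~y ~-irrefl
    ... | yes (there (here refl)) = contradiction refl x≢zs
    ... | yes (there (there x∈)) with _ , vs , p , refl ← prefix-to x∈ =
      contradiction
        (_ , s≤s (s≤s (s≤s z≤n)) , x~y , prefix-Linked q (nonBacktracking⇒linked w)
           , prefix-Unique q (walk-unique (m≤n⇒m≤1+n ℓ≤N) w))
        (¬cycle _ (≤-trans (prefix-length q) ℓ≤N))
      where q = y ∷ _ ∷ p

    -- Moves the vertices of x ∷ xs one by one onto x ∷ ys, and so forms the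
    -- closed walk that runs back along the first walk and on along the second.
    no-closed-pair : ∀ {a b x} (xs : Vec (Fin n) a) (ys : Vec (Fin n) b) →
                     a + b ≤ N → Walk (x ∷ xs) → Walk (x ∷ ys) →
                     (∀ {c z} {zs : Vec (Fin n) c} → Prefix (z ∷ zs) xs → z ≢head ys) →
                     ¬ (Vec.last (x ∷ xs) ∈ ys)
    no-closed-pair [] ys b≤N _ w _ x∈ys with x∉ys ∷ _ ← walk-unique (s≤s b≤N) w =
      VecAll.lookup x∉ys x∈ys refl
    no-closed-pair {suc a} {b} {x} (y ∷ xs) ys a+b≤N (step x~y x≢xs w) w′ diff last∈ys =
      no-closed-pair xs (x ∷ ys) (subst (_≤ N) (sym (+-suc a b)) a+b≤N) w
        -- `diff` makes the turn at `x` non-backtracking; for the next move the same condition comes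
        -- from `x≢xs`, a property of the first walk.
        (step (~-sym x~y) (diff (y ∷ [])) w′)
        (λ { (z ∷ _) z≡x → x≢xs (sym z≡x) })
        (there last∈ys)

    -- Vertices are peeled off while they agree. At the first disagreement the walks leave `x` by
    -- different neighbours, and their common last vertex contradicts `no-closed-pair`.
    walks-coincide : ∀ {a x} (xs ys : Vec (Fin n) a) → 2 * a ≤ N →
                     Walk (x ∷ xs) → Walk (x ∷ ys) →
                     Vec.last (x ∷ xs) ≡ Vec.last (x ∷ ys) → xs ≡ ys
    walks-coincide [] [] _ _ _ _ = refl
    walks-coincide {suc a} (y ∷ xs) (z ∷ ys) 2a≤N w@(step _ _ w₁) w′@(step _ _ w₁′) last≡
      with y Fin.≟ z
    ... | yes refl = cong (y ∷_)
      (walks-coincide xs ys (≤-trans (*-monoʳ-≤ 2 (n≤1+n a)) 2a≤N) w₁ w₁′ last≡)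
    ... | no y≢z = contradiction
      (subst (_∈ z ∷ ys) (sym last≡) (last∈ (z ∷ ys)))
      (no-closed-pair (y ∷ xs) (z ∷ ys) (subst (λ c → suc a + c ≤ N) (+-identityʳ (suc a)) 2a≤N)
        w w′ (λ { (_ ∷ _) → y≢z }))

-- Choosing neighbours

module _ {A : Set} where

  lookup-injective : ∀ {xs : List A} → List.Unique xs → Injective _≡_ _≡_ (List.lookup xs)
  lookup-injective (_ ∷ _)    {zero}  {zero}  _  = refl
  lookup-injective (x∉xs ∷ _) {zero}  {suc j} eq = contradiction eq (All.lookup x∉xs (∈-lookup j))
  lookup-injective (x∉xs ∷ _) {suc i} {zero}  eq = contradiction (sym eq) (All.lookup x∉xs (∈-lookup i))
  lookup-injective (_ ∷ xs!)  {suc i} {suc j} eq = cong suc (lookup-injective xs! eq)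

module _ {n : ℕ} where
  open import Data.List.Membership.DecPropositional (Fin._≟_ {n}) using (_∈?_)

  -- Provides the onward choices of a walk that must not return to `e`. If `e` is listed, `punchIn`
  -- skips its position.
  enumerate-avoiding : ∀ {m} {xs : List (Fin n)} → List.Unique xs → length xs ≡ suc m → ∀ e →
    Σ[ f ∈ (Fin m → Fin n) ] Injective _≡_ _≡_ f × (∀ c → f c List.∈ xs) × (∀ c → f c ≢ e)
  enumerate-avoiding {xs = xs@(_ ∷ _)} xs! refl e with e ∈? xs
  ... | yes e∈xs = List.lookup xs ∘ punchIn i
                 , Fin.punchIn-injective i _ _ ∘ lookup-injective xs!
                 , (λ c → ∈-lookup (punchIn i c))
                 , λ c eq → Fin.punchInᵢ≢i i c (lookup-injective xs! (trans eq (lookup-index e∈xs)))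
    where i = Any.index e∈xs
  -- There is nothing to skip, so the first entry is dropped to leave exactly `m`.
  ... | no e∉xs  = List.lookup xs ∘ suc
                 , Fin.suc-injective ∘ lookup-injective xs!
                 , (λ c → ∈-lookup (suc c))
                 , λ c eq → e∉xs (subst (List._∈ xs) eq (∈-lookup (suc c)))

-- The Moore bound

-- No step is ruled out for a walk of length 0; excluding x itself is harmless,
-- because x is not its own neighbour.
previous : ∀ {A : Set} {r} → Vec A (suc r) → A
previous (x ∷ [])    = x
previous (_ ∷ y ∷ _) = y

-- Adjoining `v` as one more value keeps the map injective. The cut of the logarithm asks for the
-- strict inequality.
injective-avoiding⇒< : ∀ {m n} {f : Fin m → Fin n} {v} →
                       Injective _≡_ _≡_ f → (∀ i → f i ≢ v) → m < n
injective-avoiding⇒< {m} {n} {f} {v} f-inj f≢v = Fin.injective⇒≤ g-inj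
  where
  g : Fin (suc m) → Fin n
  g zero    = v
  g (suc i) = f i

  g-inj : Injective _≡_ _≡_ g
  g-inj {zero}  {zero}  _  = refl
  g-inj {zero}  {suc j} eq = contradiction (sym eq) (f≢v j)
  g-inj {suc i} {zero}  eq = contradiction eq (f≢v i)
  g-inj {suc i} {suc j} eq = cong suc (f-inj eq)

module Moore {n m : ℕ} (G : Graph n) (regular : ∀ v → degree G v ≡ suc m) (v : Fin n) where
  open Graph G
  open Walks G

  module _ (u e : Fin n) where
    private
      choice = enumerate-avoiding (Unique.filter⁺ (u ~?_) (Unique.allFin⁺ n)) (regular u) e

    neighbour : Fin m → Fin n
    neighbour = proj₁ choice

    neighbour-injective : Injective _≡_ _≡_ neighbour
    neighbour-injective = proj₁ (proj₂ choice)

    neighbour-~ : ∀ c → u ~ neighbour c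
    neighbour-~ c = proj₂ (∈-filter⁻ (u ~?_) {xs = allFin n} (proj₁ (proj₂ (proj₂ choice)) c))

    neighbour-≢ : ∀ c → neighbour c ≢ e
    neighbour-≢ = proj₂ (proj₂ (proj₂ choice))

  extend : ∀ {r} → Vec (Fin n) (suc r) → Fin m → Vec (Fin n) (suc (suc r))
  extend w c = neighbour (Vec.head w) (previous w) c ∷ w

  -- The index lists the `r` choices as digits in base `m`, the latest choice being the leading
  -- digit.
  walk : ∀ r → Fin (m ^ r) → Vec (Fin n) (suc r)
  walk zero    _ = v ∷ []
  walk (suc r) i = let c , j = remQuot {m} (m ^ r) i in extend (walk r j) c

  extend-walk : ∀ {r} {w : Vec (Fin n) (suc r)} → Walk w → ∀ c → Walk (extend w c)
  extend-walk {w = x ∷ []}    nb c = step (~-sym (neighbour-~ x x c)) tt nb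
  extend-walk {w = x ∷ y ∷ _} nb c = step (~-sym (neighbour-~ x y c)) (neighbour-≢ x y c) nb

  walk-nonBacktracking : ∀ r i → Walk (walk r i)
  walk-nonBacktracking zero    _ = [-]
  walk-nonBacktracking (suc r) i = extend-walk (walk-nonBacktracking r _) _

  extend-injective : ∀ {r} {w w′ : Vec (Fin n) (suc r)} {c c′} →
                     extend w c ≡ extend w′ c′ → c ≡ c′ × w ≡ w′
  -- Equal tails make both heads values of the same `neighbour` function.
  extend-injective {w = w} {w′} eq with refl ← cong Vec.tail eq =
    neighbour-injective (Vec.head w) (previous w) (cong Vec.head eq) , refl

  walk-injective : ∀ r → Injective _≡_ _≡_ (walk r)
  walk-injective zero    {zero} {zero} _  = refl
  walk-injective (suc r) {i}    {j}    eq with c≡ , w≡ ← extend-injective eq =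
    trans (sym (Fin.combine-remQuot {m} (m ^ r) i))
      (trans (cong₂ combine c≡ (walk-injective r w≡)) (Fin.combine-remQuot {m} (m ^ r) j))

  walk-last : ∀ r i → Vec.last (walk r i) ≡ v
  walk-last zero    _ = refl
  walk-last (suc r) i = walk-last r _

  -- The constructed walks are determined by their endpoints, and none ends at `v`. The latter fails
  -- for length 0, hence `NonZero r`.
  moore : ∀ r .{{_ : NonZero r}} → (∀ ℓ → ℓ ≤ 2 * r → ¬ HasCycle _~_ ℓ) → m ^ r < n
  moore (suc r) ¬cycle = injective-avoiding⇒< {f = Vec.head ∘ walk (suc r)} endpoint-injective endpoint≢v
    where
    open Acyclic≤ (2 * suc r) ¬cycle

    same : ∀ (w w′ : Vec (Fin n) (suc (suc r))) → Walk w → Walk w′ → Vec.last w ≡ Vec.last w′ →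
           Vec.head w ≡ Vec.head w′ → w ≡ w′
    same (x ∷ xs) (_ ∷ ys) nb nb′ last≡ refl = cong (x ∷_) (walks-coincide xs ys ≤-refl nb nb′ last≡)

    endpoint-injective : Injective _≡_ _≡_ (Vec.head ∘ walk (suc r))
    endpoint-injective {i} {j} eq = walk-injective (suc r)
      (same _ _ (walk-nonBacktracking (suc r) i) (walk-nonBacktracking (suc r) j)
        (trans (walk-last (suc r) i) (sym (walk-last (suc r) j))) eq)

    endpoint≢v : ∀ i → Vec.head (walk (suc r) i) ≢ v
    endpoint≢v i eq with x∉ ∷ _ ← walk-unique (s≤s (m≤m+n (suc r) _)) (walk-nonBacktracking (suc r) i) =
      VecAll.lookup x∉ (last∈ _) (trans eq (sym (walk-last (suc r) i)))

-- The girth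

head-≤ : ∀ {N} {xs : List ℕ} → All.All (_≤ N) xs → fromMaybe 0 (head xs) ≤ N
head-≤ []        = z≤n
head-≤ (x≤N ∷ _) = x≤N

sorted-head-≤ : ∀ {ℓ} {xs : List ℕ} → ListPairs.AllPairs _<_ xs → ℓ List.∈ xs → fromMaybe 0 (head xs) ≤ ℓ
sorted-head-≤ (_ ∷ _)    (here refl)  = ≤-refl
sorted-head-≤ (x<xs ∷ _) (there ℓ∈xs) = <⇒≤ (All.lookup x<xs ℓ∈xs)

module _ {n : ℕ} (G : Graph n) where
  open Graph G

  girth-≤ : girth G ≤ n
  girth-≤ = head-≤ (All.tabulate λ ℓ∈ →
    ≤-pred (∈-upTo⁻ (proj₁ (∈-filter⁻ (hasCycle? _~?_) {xs = upTo (suc n)} ℓ∈))))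

  -- The hypothesis and `girth-≤` place `ℓ` in the range searched, and filtering keeps that range
  -- increasing. If no cycle is found, the default 0 makes the claim vacuous.
  girth-minimal : ∀ ℓ → ℓ < girth G → ¬ HasCycle _~_ ℓ
  girth-minimal ℓ ℓ<g c = <⇒≱ ℓ<g (sorted-head-≤
    (AllPairs.filter⁺ (hasCycle? _~?_) (AllPairs.applyUpTo⁺₁ _ (suc n) (λ i<j _ → i<j)))
    (∈-filter⁺ (hasCycle? _~?_) (∈-upTo⁺ (m≤n⇒m≤1+n (≤-trans ℓ<g girth-≤))) c))

  cycle-≥3 : ∀ ℓ → HasCycle _~_ ℓ → 3 ≤ ℓ
  cycle-≥3 _ (_ ∷ _ , 3≤ℓ , _) = 3≤ℓ

  -- For girth at least 3, `suc h` is the largest `r` with `2 * r < girth G`, so the girth is at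
  -- most 2r + 2, hence at most 4r. For the default girth 0, truncated subtraction gives radius 1.
  girth-radius : ∃ λ r → NonZero r × girth G ≤ 4 * r × (∀ ℓ → ℓ ≤ 2 * r → ¬ HasCycle _~_ ℓ)
  girth-radius = suc h , _ , g≤4r , ¬cycle
    where
    open ≤-Reasoning
    g = girth G
    h = (g ∸ 3) / 2

    g≤4r : g ≤ 4 * suc h
    g≤4r = begin
      g                            ≤⟨ m≤n+m∸n g 3 ⟩
      3 + (g ∸ 3)                  ≡⟨ cong (λ z → 3 + z) (m≡m%n+[m/n]*n (g ∸ 3) 2) ⟩
      3 + ((g ∸ 3) % 2 + h * 2)    ≤⟨ +-monoʳ-≤ 3 (+-monoˡ-≤ (h * 2) (≤-pred (m%n<n (g ∸ 3) 2))) ⟩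
      4 + h * 2                    ≤⟨ +-monoʳ-≤ 4 (*-monoʳ-≤ h (s≤s (s≤s z≤n))) ⟩
      4 + h * 4                    ≡⟨ *-comm (suc h) 4 ⟩
      4 * suc h                    ∎

    ¬cycle : ∀ ℓ → ℓ ≤ 2 * suc h → ¬ HasCycle _~_ ℓ
    ¬cycle ℓ ℓ≤2r c = girth-minimal ℓ (subst (ℓ <_) (m+[n∸m]≡n 3≤g) (s≤s ℓ≤)) c
      where
      ℓ≤ : ℓ ≤ 2 + (g ∸ 3)
      ℓ≤ = begin
        ℓ            ≤⟨ ℓ≤2r ⟩
        2 * suc h    ≡⟨ *-comm 2 (suc h) ⟩
        2 + h * 2    ≤⟨ +-monoʳ-≤ 2 (m/n*n≤m (g ∸ 3) 2) ⟩
        2 + (g ∸ 3)  ∎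

      3≤g : 3 ≤ g
      -- Otherwise `g ∸ 3` is 0, and `ℓ` would be a cycle length of at most 2.
      3≤g = ≮⇒≥ λ g<3 → <⇒≱ (cycle-≥3 ℓ c)
        (subst (λ z → ℓ ≤ 2 + z) (m≤n⇒m∸n≡0 (<⇒≤ g<3)) ℓ≤)

-- The number of spanning trees

module _ {A B : Set} {P : Pred B 0ℓ} {Q : Pred A 0ℓ} (P? : Decidable P) (Q? : Decidable Q)
         {f : A → B} (P⇒Q : ∀ {x} → P (f x) → Q x) where

  length-filter-map : ∀ xs → length (filter P? (List.map f xs)) ≤ length (filter Q? xs)
  length-filter-map []       = z≤n
  length-filter-map (x ∷ xs) with P? (f x) | Q? x
  ... | yes _ | yes _ = s≤s (length-filter-map xs)
  ... | yes p | no ¬q = contradiction (P⇒Q p) ¬q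
  ... | no _  | yes _ = m≤n⇒m≤1+n (length-filter-map xs)
  ... | no _  | no _  = length-filter-map xs

module _ {A B : Set} {P : Pred (A × B) 0ℓ} (P? : Decidable P) (ys : List B) {k : ℕ}
         (row-≤ : ∀ x → length (filter P? (List.map (x ,_) ys)) ≤ k) where

  length-filter-cartesianProduct : ∀ xs → length (filter P? (cartesianProduct xs ys)) ≤ length xs * k
  length-filter-cartesianProduct []       = z≤n
  length-filter-cartesianProduct (x ∷ xs) = begin
    length (filter P? (List.map (x ,_) ys List.++ cartesianProduct xs ys))
      ≡⟨ cong length (filter-++ P? (List.map (x ,_) ys) _) ⟩
    length (filter P? (List.map (x ,_) ys) List.++ filter P? (cartesianProduct xs ys))
      ≡⟨ length-++ (filter P? (List.map (x ,_) ys)) ⟩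
    length (filter P? (List.map (x ,_) ys)) + length (filter P? (cartesianProduct xs ys))
      ≤⟨ +-mono-≤ (row-≤ x) (length-filter-cartesianProduct xs) ⟩
    length (x ∷ xs) * k ∎
    where open ≤-Reasoning

length-sublists : ∀ {A : Set} (xs : List A) → length (sublists xs) ≡ 2 ^ length xs
length-sublists []       = refl
length-sublists (x ∷ xs) = begin
  length (List.map (x ∷_) (sublists xs) List.++ sublists xs)
    ≡⟨ length-++ (List.map (x ∷_) (sublists xs)) ⟩
  length (List.map (x ∷_) (sublists xs)) + length (sublists xs)
    ≡⟨ cong (_+ length (sublists xs)) (length-map (x ∷_) (sublists xs)) ⟩
  length (sublists xs) + length (sublists xs)
    ≡⟨ solve 1 (λ y → y :+ y := con 2 :* y) refl (length (sublists xs)) ⟩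
  2 * length (sublists xs)
    ≡⟨ cong (2 *_) (length-sublists xs) ⟩
  2 ^ length (x ∷ xs) ∎
  where open ≡-Reasoning

module _ {n k : ℕ} (G : Graph n) (regular : ∀ v → degree G v ≡ k) where
  open Graph G

  -- The edges with smaller endpoint `u` are among the `k` edges at `u`.
  length-edges : length (edges G) ≤ n * k
  length-edges = subst (λ z → length (edges G) ≤ z * k) (length-tabulate {n = n} (λ i → i))
    (length-filter-cartesianProduct _ (allFin n)
      (λ u → ≤-trans (length-filter-map _ (u ~?_) proj₂ (allFin n)) (≤-reflexive (regular u)))
      (allFin n))

  τ-≤ : τ G ≤ 2 ^ (n * k)
  τ-≤ = begin
    τ G                          ≤⟨ length-filter (λ F → isTree? (joined? F)) (sublists (edges G)) ⟩
    length (sublists (edges G))  ≡⟨ length-sublists (edges G) ⟩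
    2 ^ length (edges G)         ≤⟨ ^-monoʳ-≤ 2 length-edges ⟩
    2 ^ (n * k)                  ∎
    where open ≤-Reasoning

-- As `n` is at most kn/3, the difference kn/2 - n is at least kn/6. The summand 1 of `dimFlows`
-- absorbs the rounding of the division.
dimFlows-≥ : ∀ n k → 3 ≤ k → n * k ≤ 6 * dimFlows n k
dimFlows-≥ n k 3≤k = +-cancelʳ-≤ (6 * n) (n * k) (6 * dimFlows n k) (begin
  n * k + 6 * n                  ≡⟨ solve 2 (λ n k → n :* k :+ con 6 :* n := n :* k :+ con 2 :* (n :* con 3)) refl n k ⟩
  n * k + 2 * (n * 3)            ≤⟨ +-monoʳ-≤ (n * k) (*-monoʳ-≤ 2 (*-monoʳ-≤ n 3≤k)) ⟩
  n * k + 2 * (n * k)            ≡⟨ solve 2 (λ n k → n :* k :+ con 2 :* (n :* k) := con 3 :* (k :* n)) refl n k ⟩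
  3 * (k * n)                    ≡⟨ cong (3 *_) (m≡m%n+[m/n]*n (k * n) 2) ⟩
  3 * ((k * n) % 2 + h * 2)      ≤⟨ *-monoʳ-≤ 3 (+-monoˡ-≤ (h * 2) (<⇒≤ (m%n<n (k * n) 2))) ⟩
  3 * (2 + h * 2)                ≡⟨ solve 1 (λ h → con 3 :* (con 2 :+ h :* con 2) := con 6 :+ con 6 :* h) refl h ⟩
  6 + 6 * h                      ≤⟨ +-monoʳ-≤ 6 (*-monoʳ-≤ 6 (m≤n+m∸n h n)) ⟩
  6 + 6 * (n + (h ∸ n))          ≡⟨ solve 2 (λ n x → con 6 :+ con 6 :* (n :+ x) := con 6 :* (con 1 :+ x) :+ con 6 :* n) refl n (h ∸ n) ⟩
  6 * dimFlows n k + 6 * n       ∎)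
  where
  open ≤-Reasoning
  h = k * n / 2

-- The exponent 12 is the factor 6 of `dimFlows-≥`, doubled by the square.
τ²-≤ : ∀ {n k c} (G : Graph n) → 3 ≤ k → (∀ v → degree G v ≡ k) → 2 ^ 12 ≤ c →
       τ G ^ 2 ≤ c ^ dimFlows n k
τ²-≤ {n} {k} {c} G 3≤k regular 2¹²≤c = begin
  τ G ^ 2            ≤⟨ ^-monoˡ-≤ 2 (≤-trans (τ-≤ G regular) (^-monoʳ-≤ 2 (dimFlows-≥ n k 3≤k))) ⟩
  (2 ^ (6 * d)) ^ 2  ≡⟨ ^-*-assoc 2 (6 * d) 2 ⟩
  2 ^ (6 * d * 2)    ≡⟨ cong (2 ^_) (solve 1 (λ d → con 6 :* d :* con 2 := con 12 :* d) refl d) ⟩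
  2 ^ (12 * d)       ≡⟨ ^-*-assoc 2 12 d ⟨
  (2 ^ 12) ^ d       ≤⟨ ^-monoˡ-≤ d 2¹²≤c ⟩
  c ^ d              ∎
  where
  open ≤-Reasoning
  d = dimFlows n k

-- Bounds on real numbers

ℕ→ℚᵘ : ℕ → ℚᵘ
ℕ→ℚᵘ m = mkℚᵘ (+ m) 0

-/1≤ : ∀ {p q c} → p ≤ c * suc q → mkℚᵘ (+ p) q ℚ.≤ ℕ→ℚᵘ c
-/1≤ {p} {q} {c} le = ℚ.*≤* (subst₂ ℤ._≤_ (ℤ.pos-* p 1) (ℤ.pos-* c (suc q))
  (ℤ.+≤+ (subst (_≤ c * suc q) (sym (*-identityʳ p)) le)))

0≤ℕ→ℚᵘ : ∀ c → 0ℚᵘ ℚ.≤ ℕ→ℚᵘ c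
0≤ℕ→ℚᵘ c = -/1≤ z≤n

negative-≤ : ∀ {p q} c → mkℚᵘ -[1+ p ] q ℚ.≤ ℕ→ℚᵘ c
negative-≤ c = ℚ.≤-trans (ℚ.*≤* ℤ.-≤+) (0≤ℕ→ℚᵘ c)

UpperBound : ℕ → ℝ≥0 → Set
UpperBound c x = ∀ a → Below x a → a ℚ.≤ ℕ→ℚᵘ c

fromℕ-upperBound : ∀ {m c} → m ≤ c → UpperBound c (fromℕ m)
fromℕ-upperBound m≤c (mkℚᵘ (+ p) q)    lt = -/1≤ (≤-trans (<⇒≤ lt) (*-monoˡ-≤ (suc q) m≤c))
fromℕ-upperBound _   (mkℚᵘ -[1+ _ ] _) _  = negative-≤ _

^-*-distribʳ : ∀ m n d → (m * n) ^ d ≡ m ^ d * n ^ d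
^-*-distribʳ m n zero    = refl
^-*-distribʳ m n (suc d) = trans (cong (m * n *_) (^-*-distribʳ m n d))
  (solve 4 (λ a b x y → a :* b :* (x :* y) := a :* x :* (b :* y)) refl m n (m ^ d) (n ^ d))

-- The `d`-th power of a fraction above `c` is at least `c ^ d`, hence at least `t ^ e`, so that
-- fraction lies outside the cut.
power-upperBound : ∀ {t e c} d .{{_ : NonZero d}} → t ^ e ≤ c ^ d → UpperBound c (t ^[ e / d ])
power-upperBound {t} {e} {c} d t^e≤c^d (mkℚᵘ (+ p) q) lt = -/1≤ (≮⇒≥ λ cq<p → <⇒≱ lt (begin
  t ^ e * suc q ^ d    ≤⟨ *-monoˡ-≤ (suc q ^ d) t^e≤c^d ⟩
  c ^ d * suc q ^ d    ≡⟨ ^-*-distribʳ c (suc q) d ⟨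
  (c * suc q) ^ d      ≤⟨ ^-monoˡ-≤ d (<⇒≤ cq<p) ⟩
  p ^ d                ∎))
  where open ≤-Reasoning
power-upperBound d _ (mkℚᵘ -[1+ _ ] _) _ = negative-≤ _

-- The bound `s * r * c` on the left factors is regrouped as `s * c` times `r`. The cuts are open,
-- so the successor is what puts `s * c` below the constant.
*ᴿ-≤ : ∀ {x y z} s r c → UpperBound (s * r) x → UpperBound c y → Below z (ℕ→ℚᵘ r) →
       x *ᴿ y ≤ᴿ fromℕ (suc (s * c)) *ᴿ z
*ᴿ-≤ s r c x≤ y≤ r<z q (inj₁ q<0) = inj₁ q<0
*ᴿ-≤ s r c x≤ y≤ r<z q (inj₂ (a , b , 0≤a , 0≤b , a<x , b<y , q≤ab)) =
  inj₂ (ℕ→ℚᵘ (s * c) , ℕ→ℚᵘ r , 0≤ℕ→ℚᵘ (s * c) , 0≤ℕ→ℚᵘ r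
       , subst (s * c <_) (sym (*-identityʳ (suc (s * c)))) (n<1+n (s * c)) , r<z , q≤)
  where
  q≤ : q ℚ.≤ ℕ→ℚᵘ (s * c) ℚ.* ℕ→ℚᵘ r
  q≤ = ℚ.≤-trans q≤ab (ℚ.≤-trans
    (ℚ.*-mono-≤-nonNeg {{ℚ.nonNegative 0≤a}} {{ℚ.nonNegative 0≤b}} (x≤ a a<x) (y≤ b b<y))
    (ℚ.≤-reflexive (ℚ.*≡* (cong (ℤ._* + 1) (trans (sym (ℤ.pos-* (s * r) c))
      (trans (cong +_ (solve 3 (λ s r c → s :* r :* c := s :* c :* r) refl s r c))
        (ℤ.pos-* (s * c) r)))))))

-- The bound on the normalized minimal norm

ν-≤ : ∀ k (k≥3 : 3 ≤ k) c → 2 ^ 12 ≤ c → ∀ n (G : 𝒳 n k) →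
      ν G ≤ᴿ fromℕ (suc (4 * c)) *ᴿ log (k ∸ 1) n (∸-monoˡ-≤ 1 k≥3) (𝒳.nonempty G)
ν-≤ k@(suc m) k≥3 c 2¹²≤c n G =
  let open 𝒳 G
      r , r≢0 , g≤4r , ¬cycle = girth-radius graph
  in *ᴿ-≤ {fromℕ (girth graph)} {τ graph ^[ 2 / dimFlows n k ]}
          {log m n (∸-monoˡ-≤ 1 k≥3) nonempty} 4 r c
       (fromℕ-upperBound g≤4r)
       (power-upperBound {τ graph} {2} (dimFlows n k) (τ²-≤ graph k≥3 regular 2¹²≤c))
       -- The Moore bound, at vertex 0, says that the fraction r / 1 lies in the cut of the
       -- logarithm to base k - 1.
       (subst (m ^ r <_) (sym (^-identityʳ n))
         (Moore.moore graph regular (Fin.fromℕ< nonempty) r {{r≢0}} ¬cycle))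

proposition4p4 : (k : ℕ) (k≥3 : 3 ≤ k) →
    Σ[ C ∈ ℝ≥0 ] ((n : ℕ) (G : 𝒳 n k) →
    ν G ≤ᴿ C *ᴿ log (k ∸ 1) n (∸-monoˡ-≤ 1 k≥3) (𝒳.nonempty G))
-- The 4 comes from `girth-radius`, the power of 2 from the count of spanning trees.
proposition4p4 k k≥3 = fromℕ (suc (4 * 2 ^ 12)) , ν-≤ k k≥3 (2 ^ 12) ≤-refl
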